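{- $\mathsf{SCAC^{small}}\equiv_{\mathrm{sW}}\mathsf{SCAC^{large}}\equiv_{\mathrm{sW}}\mathsf{SCAC^{type}}$, i.e. these three problems are pairwise strongly Weihrauch reducible to one another.
   Context: A poset $(P,\le_P)$ consists of $P\subseteq\omega$ and a reflexive, antisymmetric, transitive relation $\le_P$; chains (antichains) are sets of pairwise comparable (incomparable) elements. In an infinite poset, $x$ is small if $x\le_P y$ for all but finitely many $y\in P$, large if $y\le_P x$ for all but finitely many $y$, isolated if $x$ is incomparable with all but finitely many $y$. A stable poset is of the small type if every element is small or isolated, and of the large type if every element is large or isolated. $\mathsf{SCAC^{small}}$ (resp. $\mathsf{SCAC^{large}}$) is the problem whose instances are infinite stable posets of the small (resp. large) type with $P\subseteq\omega$, and whose solutions are infinite chains or infinite antichains of the instance. $\mathsf{SCAC^{type}}$ has instances $(P,\le_P,T)$ where $(P,\le_P)$ is an infinite stable poset, $T\in\{S,L\}$, and $T=S$ (resp. $T=L$) implies the poset is of the small (resp. large) type; solutions are infinite chains or infinite antichains of $(P,\le_P)$. $\mathsf P\le_{\mathrm{sW}}\mathsf Q$ means there are fixed Turing functionals $\Phi,\Psi$ such that for every $\mathsf P$-instance $X$, $\Phi^X$ is a $\mathsf Q$-instance and for every solution $\hat Y$ of $\Phi^X$, $\Psi^{\hat Y}$ is a solution of $X$. -}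

module Defs where

open import Data.Nat using (ℕ; _≤_)
open import Data.Bool using (Bool; true; false)
open import Data.Product using (Σ; ∃; _×_; _,_)
open import Data.Sum using (_⊎_)
open import Relation.Nullary using (¬_)
open import Relation.Binary.PropositionalEquality using (_≡_; _≢_)

SetOracle : Set
SetOracle = ℕ → Bool

RelOracle : Set
RelOracle = ℕ → ℕ → Bool

_∈_ : ℕ → SetOracle → Set
x ∈ A = A x ≡ true

PosetData : Set
PosetData = SetOracle × RelOracle

module _ (P : SetOracle) (R : RelOracle) where

  _≤P_ : ℕ → ℕ → Set
  x ≤P y = R x y ≡ true

  IsPoset : Set
  IsPoset =
    (∀ x → x ∈ P → x ≤P x) ×
    (∀ x y → x ∈ P → y ∈ P → x ≤P y → y ≤P x → x ≡ y) ×
    (∀ x y z → x ∈ P → y ∈ P → z ∈ P → x ≤P y → y ≤P z → x ≤P z)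

  AlmostAll : (ℕ → Set) → Set
  AlmostAll Q = Σ ℕ λ N → ∀ y → N ≤ y → y ∈ P → Q y

  Small : ℕ → Set
  Small x = AlmostAll (λ y → x ≤P y)

  Large : ℕ → Set
  Large x = AlmostAll (λ y → y ≤P x)

  Isolated : ℕ → Set
  Isolated x = AlmostAll (λ y → ¬ (x ≤P y) × ¬ (y ≤P x))

  SmallType : Set
  SmallType = ∀ x → x ∈ P → Small x ⊎ Isolated x

  LargeType : Set
  LargeType = ∀ x → x ∈ P → Large x ⊎ Isolated x

  IsStable : Set
  IsStable = SmallType ⊎ LargeType

  IsChain : SetOracle → Set
  IsChain Y = (∀ x → x ∈ Y → x ∈ P) ×
              (∀ x y → x ∈ Y → y ∈ Y → x ≤P y ⊎ y ≤P x)

  IsAntichain : SetOracle → Set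
  IsAntichain Y = (∀ x → x ∈ Y → x ∈ P) ×
                  (∀ x y → x ∈ Y → y ∈ Y → x ≢ y → ¬ (x ≤P y) × ¬ (y ≤P x))

Infinite : SetOracle → Set
Infinite A = ∀ n → Σ ℕ λ m → n ≤ m × m ∈ A

IsSolution : PosetData → SetOracle → Set
IsSolution (P , R) Y = Infinite Y × (IsChain P R Y ⊎ IsAntichain P R Y)

record Problem : Set₁ where
  field
    Inst    : Set
    IsInst  : Inst → Set
    Sol     : Inst → SetOracle → Set

open Problem

-- Strong Weihrauch reducibility. Turing functionals are modelled as
-- (necessarily computable, since --safe Agda) Agda functions on oracles.
_≤sW_ : Problem → Problem → Set
𝒫 ≤sW 𝒬 =
  Σ (Inst 𝒫 → Inst 𝒬) λ Φ →
  Σ (SetOracle → SetOracle) λ Ψ →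
  ∀ X → IsInst 𝒫 X →
    IsInst 𝒬 (Φ X) × (∀ Ŷ → Sol 𝒬 (Φ X) Ŷ → Sol 𝒫 X (Ψ Ŷ))

data Type : Set where
  S L : Type

SCAC-small : Problem
SCAC-small = record
  { Inst = PosetData
  ; IsInst = λ { (P , R) → Infinite P × IsPoset P R × IsStable P R × SmallType P R }
  ; Sol = IsSolution }

SCAC-large : Problem
SCAC-large = record
  { Inst = PosetData
  ; IsInst = λ { (P , R) → Infinite P × IsPoset P R × IsStable P R × LargeType P R }
  ; Sol = IsSolution }

SCAC-type : Problem
SCAC-type = record
  { Inst = PosetData × Type
  ; IsInst = λ { ((P , R) , T) → Infinite P × IsPoset P R × IsStable P R ×
                   (T ≡ S → SmallType P R) × (T ≡ L → LargeType P R) }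
  ; Sol = λ { (D , T) Y → IsSolution D Y } }

_≡sW_ : Problem → Problem → Set
𝒫 ≡sW 𝒬 = (𝒫 ≤sW 𝒬) × (𝒬 ≤sW 𝒫)

{-# OPTIONS --safe #-}
module Submission where

-- Reversing the order of a poset turns small elements into large ones and
-- vice versa, keeps isolated elements isolated, and has exactly the same
-- chains and antichains; so reversal (with the identity on solutions) reduces
-- each of SCAC-small and SCAC-large to the other. The tag of an SCAC-type
-- instance tells whether to reverse before handing it to SCAC-large, and
-- SCAC-small is compared with SCAC-type through SCAC-large.

open import Defs
open import Data.Product using (_×_; _,_)
import Data.Product as Product
open import Data.Sum using (inj₁; inj₂)
import Data.Sum as Sum
open import Function using (id; flip; _∘_)
open import Relation.Binary.PropositionalEquality using (refl)

open Problem

≤sW-trans : ∀ {𝒫 𝒬 ℛ} → 𝒫 ≤sW 𝒬 → 𝒬 ≤sW ℛ → 𝒫 ≤sW ℛ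
≤sW-trans (Φ₁ , Ψ₁ , reduce₁) (Φ₂ , Ψ₂ , reduce₂) =
  Φ₂ ∘ Φ₁ , Ψ₁ ∘ Ψ₂ , λ X X-inst →
    let (Φ₁X-inst , back₁) = reduce₁ X X-inst
        (Φ₂Φ₁X-inst , back₂) = reduce₂ (Φ₁ X) Φ₁X-inst
    in Φ₂Φ₁X-inst , λ Ŷ → back₁ (Ψ₂ Ŷ) ∘ back₂ Ŷ

≡sW-trans : ∀ {𝒫 𝒬 ℛ} → 𝒫 ≡sW 𝒬 → 𝒬 ≡sW ℛ → 𝒫 ≡sW ℛ
≡sW-trans {𝒫} {𝒬} {ℛ} (𝒫≤𝒬 , 𝒬≤𝒫) (𝒬≤ℛ , ℛ≤𝒬) =
  ≤sW-trans {𝒫} {𝒬} {ℛ} 𝒫≤𝒬 𝒬≤ℛ , ≤sW-trans {ℛ} {𝒬} {𝒫} ℛ≤𝒬 𝒬≤𝒫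

dual : PosetData → PosetData
dual (P , R) = P , flip R

module _ {P : SetOracle} {R : RelOracle} where

  flip-isPoset : IsPoset P R → IsPoset P (flip R)
  flip-isPoset (reflexive , antisym , trans) =
    reflexive ,
    (λ x y x∈P y∈P y≤x x≤y → antisym x y x∈P y∈P x≤y y≤x) ,
    (λ x y z x∈P y∈P z∈P y≤x z≤y → trans z y x z∈P y∈P x∈P z≤y y≤x)

  flip-isolated : ∀ {x} → Isolated P R x → Isolated P (flip R) x
  flip-isolated (N , incomparable) =
    N , λ y N≤y y∈P → Product.swap (incomparable y N≤y y∈P)

  smallType⇒flip-largeType : SmallType P R → LargeType P (flip R)
  smallType⇒flip-largeType smallType x x∈P = Sum.map₂ flip-isolated (smallType x x∈P)

  largeType⇒flip-smallType : LargeType P R → SmallType P (flip R)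
  largeType⇒flip-smallType largeType x x∈P = Sum.map₂ flip-isolated (largeType x x∈P)

  flip-isChain : ∀ {Y} → IsChain P (flip R) Y → IsChain P R Y
  flip-isChain (Y⊆P , comparable) =
    Y⊆P , λ x y x∈Y y∈Y → Sum.swap (comparable x y x∈Y y∈Y)

  flip-isAntichain : ∀ {Y} → IsAntichain P (flip R) Y → IsAntichain P R Y
  flip-isAntichain (Y⊆P , incomparable) =
    Y⊆P , λ x y x∈Y y∈Y x≢y → Product.swap (incomparable x y x∈Y y∈Y x≢y)

  dual-isSolution : ∀ {Y} → IsSolution (dual (P , R)) Y → IsSolution (P , R) Y
  dual-isSolution = Product.map₂ (Sum.map flip-isChain flip-isAntichain)

small≤sWlarge : SCAC-small ≤sW SCAC-large
small≤sWlarge = dual , id , λ where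
  (P , R) (infinite , poset , _ , smallType) →
    let largeType = smallType⇒flip-largeType smallType
    in (infinite , flip-isPoset poset , inj₂ largeType , largeType) , λ _ → dual-isSolution

large≤sWsmall : SCAC-large ≤sW SCAC-small
large≤sWsmall = dual , id , λ where
  (P , R) (infinite , poset , _ , largeType) →
    let smallType = largeType⇒flip-smallType largeType
    in (infinite , flip-isPoset poset , inj₁ smallType , smallType) , λ _ → dual-isSolution

large≤sWtype : SCAC-large ≤sW SCAC-type
large≤sWtype = (_, L) , id , λ where
  (P , R) (infinite , poset , stable , largeType) →
    (infinite , poset , stable , (λ ()) , (λ _ → largeType)) , λ _ → id

type≤sWlarge : SCAC-type ≤sW SCAC-large
type≤sWlarge = toLarge , id , reduce
  where
  toLarge : PosetData × Type → PosetData
  toLarge (D , S) = dual D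
  toLarge (D , L) = D

  reduce : ∀ X → IsInst SCAC-type X →
           IsInst SCAC-large (toLarge X) × (∀ Ŷ → IsSolution (toLarge X) Ŷ → Sol SCAC-type X Ŷ)
  reduce ((P , R) , S) (infinite , poset , _ , small , _) =
    let largeType = smallType⇒flip-largeType (small refl)
    in (infinite , flip-isPoset poset , inj₂ largeType , largeType) , λ _ → dual-isSolution
  reduce ((P , R) , L) (infinite , poset , stable , _ , large) =
    (infinite , poset , stable , large refl) , λ _ → id

proposition1 : (SCAC-small ≡sW SCAC-large) × (SCAC-large ≡sW SCAC-type) × (SCAC-small ≡sW SCAC-type)
proposition1 =
  small≡sWlarge ,
  large≡sWtype ,
  ≡sW-trans {SCAC-small} {SCAC-large} {SCAC-type} small≡sWlarge large≡sWtype
  where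
  small≡sWlarge : SCAC-small ≡sW SCAC-large
  small≡sWlarge = small≤sWlarge , large≤sWsmall

  large≡sWtype : SCAC-large ≡sW SCAC-type
  large≡sWtype = large≤sWtype , type≤sWlarge
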